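{- Let $0\le k\le d$ be integers. Suppose we are given $d-k+1$ pairs $\{H_i^0,H_i^1\}$, $i=1,\dots,d-k+1$, of $k$-flats in $\mathbb{R}^d$. Then there exists a partition of these $2(d-k+1)$ flats into two collections $A,B$ such that each of $A$ and $B$ contains exactly one $k$-flat from each pair (that is, for some $\varepsilon_1,\dots,\varepsilon_{d-k+1}\in\{0,1\}$, $A$ consists of the flats $H_i^{\varepsilon_i}$ and $B$ consists of the flats $H_i^{1-\varepsilon_i}$), and such that $\operatorname{conv}\left(\bigcup A\right)\cap\operatorname{conv}\left(\bigcup B\right)$ contains a $k$-flat.
   Context: A $k$-flat in $\mathbb{R}^d$ is a $k$-dimensional affine subspace (a $0$-flat is a point). $\bigcup A$ denotes the union, as a subset of $\mathbb{R}^d$, of all the flats in $A$, and $\operatorname{conv}$ denotes the convex hull (no closure is taken). -}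

module Defs where

open import Algebra.Bundles using (CommutativeRing)
import Algebra.Properties.Semiring.Sum as SemiringSum
open import Data.Nat.Base using (ℕ)
open import Data.Product.Base using (Σ; ∃; _×_)
open import Data.Vec.Functional using (Vector; zipWith)
import Data.Vec.Functional.Relation.Binary.Equality.Setoid as VectorEquality
open import Level using (Level; suc)
open import Relation.Binary.Core using (Rel)
open import Relation.Binary.Structures using (IsTotalOrder)
open import Relation.Nullary.Negation.Core using (¬_)
open import Relation.Unary using (Pred; Satisfiable; _≐_)

-- A Dedekind-complete ordered field, i.e. a model of ℝ (classically unique up
-- to isomorphism).
record CompleteOrderedField (ℓ : Level) : Set (suc ℓ) where
  infix 4 _≤_
  field
    commutativeRing : CommutativeRing ℓ ℓ

  open CommutativeRing commutativeRing public

  field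
    0≉1     : ¬ (0# ≈ 1#)
    inverse : ∀ x → ¬ (x ≈ 0#) → ∃ λ y → x * y ≈ 1#

    _≤_          : Rel Carrier ℓ
    isTotalOrder : IsTotalOrder _≈_ _≤_
    +-monoˡ-≤    : ∀ z {x y} → x ≤ y → x + z ≤ y + z
    *-nonNeg     : ∀ {x y} → 0# ≤ x → 0# ≤ y → 0# ≤ x * y

  UpperBound : Pred Carrier ℓ → Pred Carrier ℓ
  UpperBound P b = ∀ x → P x → x ≤ b

  field
    supremum : (P : Pred Carrier ℓ) → Satisfiable P → Satisfiable (UpperBound P) →
               ∃ λ s → UpperBound P s × (∀ b → UpperBound P b → s ≤ b)

module EuclideanSpace {ℓ : Level} (ℝ : CompleteOrderedField ℓ) where

  open CompleteOrderedField ℝ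
  open SemiringSum semiring using (sum)
  open VectorEquality setoid using (_≋_)

  Point : ℕ → Set ℓ
  Point d = Vector Carrier d

  Subset : ℕ → Set (suc ℓ)
  Subset d = Pred (Point d) ℓ

  𝟎 : ∀ {d} → Point d
  𝟎 _ = 0#

  _⊕_ : ∀ {d} → Point d → Point d → Point d
  _⊕_ = zipWith _+_

  combination : ∀ {n d} → Vector Carrier n → Vector (Point d) n → Point d
  combination c v j = sum (λ i → c i * v i j)

  LinearlyIndependent : ∀ {n d} → Vector (Point d) n → Set ℓ
  LinearlyIndependent v = ∀ c → combination c v ≋ 𝟎 → ∀ i → c i ≈ 0#

  _+Span_ : ∀ {n d} → Point d → Vector (Point d) n → Subset d
  (p +Span v) x = ∃ λ c → x ≋ p ⊕ combination c v

  IsFlat : (k : ℕ) {d : ℕ} → Subset d → Set ℓ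
  IsFlat k {d} F =
    Σ (Point d) λ p → Σ (Vector (Point d) k) λ v →
      LinearlyIndependent v × F ≐ (p +Span v)

  conv : ∀ {d} → Subset d → Subset d
  conv {d} S x =
    Σ ℕ λ n → Σ (Vector Carrier n) λ w → Σ (Vector (Point d) n) λ y →
      (∀ i → 0# ≤ w i) × sum w ≈ 1# × (∀ i → S (y i)) × x ≋ combination w y

{-# OPTIONS --safe #-}
module Submission where

open import Defs
open import Axiom.ExcludedMiddle using (ExcludedMiddle)
import Algebra.Properties.AbelianGroup as AbelianGroupProperties
import Algebra.Properties.Ring as RingProperties
import Algebra.Properties.Semiring.Sum as SemiringSum
import Algebra.Solver.Ring.NaturalCoefficients.Default as SemiringSolver
open import Data.Bool.Base using (Bool; true; false; not)
open import Data.Fin.Base using (Fin; zero; suc; _↑ˡ_; _↑ʳ_; punchIn; splitAt)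
open import Data.Fin.Properties using (¬∀⟶∃¬; splitAt⁻¹-↑ˡ; splitAt⁻¹-↑ʳ)
open import Data.Nat.Base as ℕ using (ℕ; zero; suc)
import Data.Nat.Properties as ℕₚ
open import Data.Product.Base using (Σ; ∃; _×_; _,_; proj₁; proj₂)
open import Data.Sum.Base using (_⊎_; inj₁; inj₂; [_,_]′)
open import Data.Vec.Functional using (Vector; _∷_; _++_; tail; take; drop; removeAt; insertAt)
open import Data.Vec.Functional.Properties using (insertAt-lookup; insertAt-punchIn; lookup-++ˡ; lookup-++ʳ)
import Data.Vec.Functional.Relation.Binary.Equality.Setoid as VectorEquality
open import Function.Base using (_∘_; id)
open import Data.Unit.Base using (⊤)
open import Level as Level using (Level; Lift)
open import Relation.Binary.PropositionalEquality.Core as ≡ using (_≡_)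
open import Relation.Binary.Structures using (IsTotalOrder)
import Relation.Binary.Reasoning.Setoid as SetoidReasoning
open import Relation.Nullary.Decidable.Core using (Dec; yes; no; decidable-stable)
open import Relation.Nullary.Negation.Core using (¬_; contradiction)
open import Relation.Unary using (_⊆_; _∩_; ⋃)

-- Write V(i,b) for the direction space of the flat H i b, and xᵢ for the
-- difference of base points of the i-th pair. If the weights cᵢ are all nonzero
-- and Σ cᵢ xᵢ lies in the sum U of all the V(i,b), put into A the flat of the
-- i-th pair named by the sign of cᵢ: weighted means of A and B with weights |cᵢ|
-- then agree modulo U = W_A + W_B, where W_A and W_B are the sums of the
-- directions in A and in B, and the two hulls contain translates of W_A and W_B
-- through a common point. So it suffices that W_A contains the direction space
-- of some flat in B. If it does not, take s + 1 flats of A whose directions span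
-- a space W of dimension at least s + k (initially s = 0). A dimension count
-- gives a relation Σ μᵢ xᵢ ∈ U, μ ≠ 0, vanishing on those pairs; moving far along
-- μ flips the sign of another pair, whose new flat in A enlarges W. This cannot
-- go on forever.

-- Finite sums of products.

module Sums {ℓ} (ℝ : CompleteOrderedField ℓ) where

  open CompleteOrderedField ℝ hiding (zero)
  open SemiringSum semiring using (sum; sum-cong-≋; ∑-distrib-+; *-distribˡ-sum; sum-remove; sum-replicate-zero)
  open SetoidReasoning setoid
  open SemiringSolver commutativeSemiring using (solve; _:=_; _:+_; _:*_)
  open RingProperties ring using (-1*x≈-x)

  dot : ∀ {n} → Vector Carrier n → Vector Carrier n → Carrier
  dot c f = sum (λ i → c i * f i)

  dot-cong : ∀ {n} {c c′ f f′ : Vector Carrier n} →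
             (∀ i → c i ≈ c′ i) → (∀ i → f i ≈ f′ i) → dot c f ≈ dot c′ f′
  dot-cong c≈ f≈ = sum-cong-≋ (λ i → *-cong (c≈ i) (f≈ i))

  dot-+ˡ : ∀ {n} (c c′ f : Vector Carrier n) → dot (λ i → c i + c′ i) f ≈ dot c f + dot c′ f
  dot-+ˡ c c′ f = trans (sum-cong-≋ (λ i → distribʳ (f i) (c i) (c′ i))) (∑-distrib-+ (λ i → c i * f i) _)

  dot-+ʳ : ∀ {n} (c f f′ : Vector Carrier n) → dot c (λ i → f i + f′ i) ≈ dot c f + dot c f′
  dot-+ʳ c f f′ = trans (sum-cong-≋ (λ i → distribˡ (c i) (f i) (f′ i))) (∑-distrib-+ (λ i → c i * f i) _)

  dot-*ˡ : ∀ {n} a (c f : Vector Carrier n) → dot (λ i → a * c i) f ≈ a * dot c f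
  dot-*ˡ a c f = trans (sum-cong-≋ (λ i → *-assoc a (c i) (f i))) (sym (*-distribˡ-sum a (λ i → c i * f i)))

  dot-*ʳ : ∀ {n} a (c f : Vector Carrier n) → dot c (λ i → a * f i) ≈ a * dot c f
  dot-*ʳ a c f = trans
    (sum-cong-≋ (λ i → solve 3 (λ c a f → c :* (a :* f) := a :* (c :* f)) refl (c i) a (f i)))
    (sym (*-distribˡ-sum a (λ i → c i * f i)))

  dot-negˡ : ∀ {n} (c f : Vector Carrier n) → dot (λ i → - c i) f ≈ - dot c f
  dot-negˡ c f = begin
    dot (λ i → - c i) f        ≈⟨ dot-cong {f = f} (λ i → sym (-1*x≈-x (c i))) (λ _ → refl) ⟩
    dot (λ i → - 1# * c i) f   ≈⟨ dot-*ˡ (- 1#) c f ⟩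
    - 1# * dot c f             ≈⟨ -1*x≈-x _ ⟩
    - dot c f                  ∎

  dot-zeroˡ : ∀ {n} {c : Vector Carrier n} (f : Vector Carrier n) → (∀ i → c i ≈ 0#) → dot c f ≈ 0#
  dot-zeroˡ {n} f c≈0 = trans (sum-cong-≋ (λ i → trans (*-congʳ (c≈0 i)) (zeroˡ (f i)))) (sum-replicate-zero n)

  dot-zeroʳ : ∀ {n} (c : Vector Carrier n) {f : Vector Carrier n} → (∀ i → f i ≈ 0#) → dot c f ≈ 0#
  dot-zeroʳ {n} c f≈0 = trans (sum-cong-≋ (λ i → trans (*-congˡ (f≈0 i)) (zeroʳ (c i)))) (sum-replicate-zero n)

  dot-insertAt : ∀ {n} (c : Vector Carrier n) p a (f : Vector Carrier (suc n)) →
                 dot (insertAt c p a) f ≈ a * f p + dot c (removeAt f p)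
  dot-insertAt c p a f = trans (sum-remove {i = p} (λ i → insertAt c p a i * f i))
    (+-cong (*-congʳ (reflexive (insertAt-lookup c p a)))
            (sum-cong-≋ (λ i → *-congʳ (reflexive (insertAt-punchIn c p a i)))))

  dot-split : ∀ m {n} (c f : Vector Carrier (m ℕ.+ n)) →
              dot c f ≈ dot (take m {n} c) (take m {n} f) + dot (drop m {n} c) (drop m {n} f)
  dot-split zero    c f = sym (+-identityˡ _)
  dot-split (suc m) c f = trans (+-congˡ (dot-split m (tail c) (tail f))) (sym (+-assoc _ _ _))

  δ : ∀ {n} → Fin n → Vector Carrier n
  δ zero    = 1# ∷ λ _ → 0#
  δ (suc i) = 0# ∷ δ i

  dot-δ : ∀ {n} (c : Vector Carrier n) i → dot c (δ i) ≈ c i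
  dot-δ c zero    = trans (+-cong (*-identityʳ _) (dot-zeroʳ (tail c) (λ _ → refl))) (+-identityʳ _)
  dot-δ c (suc i) = trans (+-cong (zeroʳ _) (dot-δ (tail c) i)) (+-identityˡ _)

-- Signs, and conditions that hold for all large values of a parameter.

module Order {ℓ} (em : ExcludedMiddle ℓ) (ℝ : CompleteOrderedField ℓ) where

  open CompleteOrderedField ℝ hiding (zero)
  open IsTotalOrder isTotalOrder using (antisym; total; ≤-respˡ-≈; ≤-respʳ-≈) renaming (trans to ≤-trans; refl to ≤-refl)
  open SemiringSum semiring using (sum)
  open SetoidReasoning setoid
  open RingProperties ring using (-1*x≈-x; -‿distribʳ-*)
  open AbelianGroupProperties +-abelianGroup using (⁻¹-involutive)
  open SemiringSolver commutativeSemiring using (solve; _:=_; _:+_; _:*_)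

  x-y+y≈x : ∀ x y → (x - y) + y ≈ x
  x-y+y≈x x y = trans (+-assoc x (- y) y) (trans (+-congˡ (-‿inverseˡ y)) (+-identityʳ x))

  *-cancel-zero : ∀ {x y} → ¬ x ≈ 0# → x * y ≈ 0# → y ≈ 0#
  *-cancel-zero {x} {y} x≉0 xy≈0 = begin
    y               ≈⟨ *-identityˡ y ⟨
    1# * y          ≈⟨ *-congʳ (proj₂ (inverse x x≉0)) ⟨
    (x * x⁻¹) * y   ≈⟨ solve 3 (λ x i y → (x :* i) :* y := i :* (x :* y)) refl x x⁻¹ y ⟩
    x⁻¹ * (x * y)   ≈⟨ *-congˡ xy≈0 ⟩
    x⁻¹ * 0#        ≈⟨ zeroʳ x⁻¹ ⟩
    0#              ∎
    where x⁻¹ = proj₁ (inverse x x≉0)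

  neg-nonNeg : ∀ {x} → x ≤ 0# → 0# ≤ - x
  neg-nonNeg {x} x≤0 = ≤-respˡ-≈ (-‿inverseʳ x) (≤-respʳ-≈ (+-identityˡ (- x)) (+-monoˡ-≤ (- x) x≤0))

  +-nonNeg : ∀ {x y} → 0# ≤ x → 0# ≤ y → 0# ≤ x + y
  +-nonNeg {x} {y} 0≤x 0≤y = ≤-trans 0≤y (≤-respˡ-≈ (+-identityˡ y) (+-monoˡ-≤ y 0≤x))

  0≤1 : 0# ≤ 1#
  0≤1 with total 0# 1#
  ... | inj₁ p = p
  ... | inj₂ q = ≤-respʳ-≈ (begin
    - 1# * - 1#  ≈⟨ -1*x≈-x (- 1#) ⟩
    - - 1#       ≈⟨ ⁻¹-involutive 1# ⟩
    1#           ∎) (*-nonNeg (neg-nonNeg q) (neg-nonNeg q))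

  Positive : Carrier → Set ℓ
  Positive x = 0# ≤ x × ¬ x ≈ 0#

  positive-resp : ∀ {x y} → x ≈ y → Positive x → Positive y
  positive-resp x≈y (0≤x , x≉0) = ≤-respʳ-≈ x≈y 0≤x , x≉0 ∘ trans x≈y

  1≰0 : ¬ 1# ≤ 0#
  1≰0 1≤0 = 0≉1 (antisym 0≤1 1≤0)

  1≤⇒positive : ∀ {x} → 1# ≤ x → Positive x
  1≤⇒positive 1≤x = ≤-trans 0≤1 1≤x , λ x≈0 → 1≰0 (≤-respʳ-≈ x≈0 1≤x)

  positive-or-negative : ∀ {x} → ¬ x ≈ 0# → Positive x ⊎ Positive (- x)
  positive-or-negative {x} x≉0 with total 0# x
  ... | inj₁ 0≤x = inj₁ (0≤x , x≉0)
  ... | inj₂ x≤0 = inj₂ (neg-nonNeg x≤0 , λ -x≈0 → x≉0 (begin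
    x        ≈⟨ +-identityʳ x ⟨
    x + 0#   ≈⟨ +-congˡ -x≈0 ⟨
    x - x    ≈⟨ -‿inverseʳ x ⟩
    0#       ∎))

  +-positive : ∀ {x y} → Positive x → 0# ≤ y → Positive (x + y)
  +-positive {x} {y} (0≤x , x≉0) 0≤y = +-nonNeg 0≤x 0≤y , λ x+y≈0 →
    x≉0 (antisym (≤-respʳ-≈ (trans (+-comm y x) x+y≈0) (≤-respˡ-≈ (+-identityˡ x) (+-monoˡ-≤ x 0≤y))) 0≤x)

  *-positive : ∀ {x y} → Positive x → Positive y → Positive (x * y)
  *-positive (0≤x , x≉0) (0≤y , y≉0) = *-nonNeg 0≤x 0≤y , y≉0 ∘ *-cancel-zero x≉0

  inverse-positive : ∀ {x y} → Positive x → x * y ≈ 1# → Positive y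
  inverse-positive {x} {y} (0≤x , _) xy≈1 = 0≤y , λ y≈0 → 0≉1 (begin
    0#      ≈⟨ zeroʳ x ⟨
    x * 0#  ≈⟨ *-congˡ y≈0 ⟨
    x * y   ≈⟨ xy≈1 ⟩
    1#      ∎)
    where
    0≤y : 0# ≤ y
    0≤y with total 0# y
    ... | inj₁ p = p
    ... | inj₂ q = contradiction
      (≤-respʳ-≈ (-‿inverseˡ 1#) (≤-respˡ-≈ (+-identityˡ 1#) (+-monoˡ-≤ 1# 0≤-1))) 1≰0
      where
      0≤-1 : 0# ≤ - 1#
      0≤-1 = ≤-respʳ-≈ (trans (sym (-‿distribʳ-* x y)) (-‿cong xy≈1)) (*-nonNeg 0≤x (neg-nonNeg q))

  sum-nonNeg : ∀ {n} (f : Vector Carrier n) → (∀ i → 0# ≤ f i) → 0# ≤ sum f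
  sum-nonNeg {zero}  f 0≤f = ≤-refl
  sum-nonNeg {suc n} f 0≤f = +-nonNeg (0≤f zero) (sum-nonNeg (tail f) (0≤f ∘ suc))

  sum-positive : ∀ {n} → Fin n → (f : Vector Carrier n) → (∀ i → Positive (f i)) → Positive (sum f)
  sum-positive {suc n} _ f 0<f = +-positive (0<f zero) (sum-nonNeg (tail f) (proj₁ ∘ 0<f ∘ suc))

  sgn : Bool → Carrier
  sgn true  = 1#
  sgn false = - 1#

  -- A strict sign: multiplying by `sgn b` yields the absolute value of `x`, and these absolute
  -- values become the weights in the hulls.
  Sign : Bool → Carrier → Set ℓ
  Sign b x = Positive (sgn b * x)

  sgn-square : ∀ b → sgn b * sgn b ≈ 1#
  sgn-square true  = *-identityˡ 1#
  sgn-square false = trans (-1*x≈-x (- 1#)) (⁻¹-involutive 1#)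

  sign-exists : ∀ {x} → ¬ x ≈ 0# → ∃ λ b → Sign b x
  sign-exists {x} x≉0 with positive-or-negative x≉0
  ... | inj₁ p = true  , positive-resp (sym (*-identityˡ x)) p
  ... | inj₂ p = false , positive-resp (sym (-1*x≈-x x)) p

  ¬positive-both : ∀ {x} → Positive x → ¬ Positive (- x)
  ¬positive-both {x} p q = proj₂ (+-positive p (proj₁ q)) (-‿inverseʳ x)

  sign-unique : ∀ {x} b b′ → Sign b x → Sign b′ x → b ≡ b′
  sign-unique true  true  _ _ = ≡.refl
  sign-unique false false _ _ = ≡.refl
  sign-unique {x} true  false p q = contradiction (positive-resp (-1*x≈-x x) q) (¬positive-both (positive-resp (*-identityˡ x) p))
  sign-unique {x} false true  p q = contradiction (positive-resp (-1*x≈-x x) p) (¬positive-both (positive-resp (*-identityˡ x) q))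

  -- This makes "moving far along" a direction precise: each of finitely many conditions holds
  -- beyond its own threshold, so a single `t` meets them all.
  Eventually : (Carrier → Set ℓ) → Set ℓ
  Eventually P = ∃ λ M → ∀ t → M ≤ t → P t

  eventually-witness : ∀ {P : Carrier → Set ℓ} → Eventually P → ∃ P
  eventually-witness (M , h) = M , h M ≤-refl

  eventually-× : ∀ {P Q : Carrier → Set ℓ} → Eventually P → Eventually Q → Eventually (λ t → P t × Q t)
  eventually-× (M , p) (N , q) with total M N
  ... | inj₁ M≤N = N , λ t N≤t → p t (≤-trans M≤N N≤t) , q t N≤t
  ... | inj₂ N≤M = M , λ t M≤t → p t M≤t , q t (≤-trans N≤M M≤t)

  eventually-∀ : ∀ {n} {P : Fin n → Carrier → Set ℓ} → (∀ i → Eventually (P i)) → Eventually (λ t → ∀ i → P i t)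
  eventually-∀ {zero}  _ = 0# , λ _ _ ()
  eventually-∀ {suc n} h with eventually-× (h zero) (eventually-∀ (h ∘ suc))
  ... | M , pq = M , λ t M≤t → λ { zero → proj₁ (pq t M≤t) ; (suc i) → proj₂ (pq t M≤t) i }

  eventually-1≤ : ∀ a → Eventually (λ t → 1# ≤ t + a)
  eventually-1≤ a = 1# - a , λ t M≤t → ≤-respˡ-≈ (x-y+y≈x 1# a) (+-monoˡ-≤ a M≤t)

  -- If `b` vanishes, the expression is constantly `a`. Otherwise multiplying by the inverse of `b`
  -- gives `t + a * b⁻¹`, which is at least 1 for large `t`.
  eventually-≉0 : ∀ {a b} → ¬ a ≈ 0# ⊎ ¬ b ≈ 0# → Eventually (λ t → ¬ a + t * b ≈ 0#)
  eventually-≉0 {a} {b} ≉0 with em {b ≈ 0#}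
  ... | yes b≈0 = 0# , λ t _ a+tb≈0 → [ (λ a≉0 → a≉0 (begin
    a            ≈⟨ +-identityʳ a ⟨
    a + 0#       ≈⟨ +-congˡ (trans (*-congˡ b≈0) (zeroʳ t)) ⟨
    a + t * b    ≈⟨ a+tb≈0 ⟩
    0#           ∎)) , (λ b≉0 → b≉0 b≈0) ]′ ≉0
  ... | no b≉0 with inverse b b≉0
  ...   | b⁻¹ , bb⁻¹≈1 with eventually-1≤ (a * b⁻¹)
  ...     | M , h = M , λ t M≤t a+tb≈0 → 1≰0 (≤-respʳ-≈ (begin
    t + a * b⁻¹                ≈⟨ +-congʳ (*-identityʳ t) ⟨
    t * 1# + a * b⁻¹           ≈⟨ +-congʳ (*-congˡ bb⁻¹≈1) ⟨
    t * (b * b⁻¹) + a * b⁻¹    ≈⟨ solve 4 (λ t b i a → t :* (b :* i) :+ a :* i := (a :+ t :* b) :* i) refl t b b⁻¹ a ⟩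
    (a + t * b) * b⁻¹          ≈⟨ *-congʳ a+tb≈0 ⟩
    0# * b⁻¹                   ≈⟨ zeroˡ b⁻¹ ⟩
    0#                         ∎) (h t M≤t))

  -- The normalisation of `s` turns `sgn b * (a + t * s)` into `t + sgn b * a`, which is at least 1
  -- for large `t`.
  eventually-sign : ∀ {s b} a → sgn b * s ≈ 1# → Eventually (λ t → Sign b (a + t * s))
  eventually-sign {s} {b} a σs≈1 with eventually-1≤ (sgn b * a)
  ... | M , h = M , λ t M≤t → positive-resp (begin
    t + sgn b * a                ≈⟨ +-congʳ (*-identityʳ t) ⟨
    t * 1# + sgn b * a           ≈⟨ +-congʳ (*-congˡ σs≈1) ⟨
    t * (sgn b * s) + sgn b * a  ≈⟨ solve 4 (λ t σ s a → t :* (σ :* s) :+ σ :* a := σ :* (a :+ t :* s)) refl t (sgn b) s a ⟩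
    sgn b * (a + t * s)          ∎) (1≤⇒positive (h t M≤t))

-- Spans and linear independence.

module LinearAlgebra {ℓ} (em : ExcludedMiddle ℓ) (ℝ : CompleteOrderedField ℓ) where

  open CompleteOrderedField ℝ hiding (zero)
  open EuclideanSpace ℝ
  open Sums ℝ
  open SemiringSum semiring using (sum-cong-≋)
  open VectorEquality setoid using (_≋_)
  open SetoidReasoning setoid
  open RingProperties ring using (-1*x≈-x; -‿distribˡ-*)
  open AbelianGroupProperties +-abelianGroup using (inverseʳ-unique)
  open SemiringSolver commutativeSemiring using (solve; _:=_; _:+_; _:*_)

  scale : ∀ {d} → Carrier → Point d → Point d
  scale a x j = a * x j

  neg : ∀ {d} → Point d → Point d
  neg x j = - x j

  -- An inductive closure, so that facts about spans follow by structural induction; `resp` is a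
  -- constructor because points are compared only coordinatewise up to `≈`.
  data Span {d} (S : Subset d) : Subset d where
    generator : ∀ {x} → S x → Span S x
    resp      : ∀ {x y} → x ≋ y → Span S x → Span S y
    zero      : Span S 𝟎
    add       : ∀ {x y} → Span S x → Span S y → Span S (x ⊕ y)
    scaled    : ∀ a {x} → Span S x → Span S (scale a x)

  span-bind : ∀ {d} {S S′ : Subset d} → S ⊆ Span S′ → Span S ⊆ Span S′
  span-bind f (generator s) = f s
  span-bind f (resp x≋y s)  = resp x≋y (span-bind f s)
  span-bind f zero          = zero
  span-bind f (add s t)     = add (span-bind f s) (span-bind f t)
  span-bind f (scaled a s)  = scaled a (span-bind f s)

  span-mono : ∀ {d} {S S′ : Subset d} → S ⊆ S′ → Span S ⊆ Span S′
  span-mono f = span-bind (generator ∘ f)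

  span-combination : ∀ {d n} {S : Subset d} (c : Vector Carrier n) (y : Vector (Point d) n) →
                     (∀ i → Span S (y i)) → Span S (combination c y)
  span-combination {n = zero}  c y h = zero
  span-combination {n = suc n} c y h =
    add (scaled (c zero) (h zero)) (span-combination (tail c) (tail y) (h ∘ suc))

  span-neg : ∀ {d} {S : Subset d} {x} → Span S x → Span S (neg x)
  span-neg s = resp (λ j → -1*x≈-x _) (scaled (- 1#) s)

  span-complement : ∀ {d} {S : Subset d} {y z} → z ⊕ y ≋ 𝟎 → Span S z → Span S y
  span-complement z⊕y≋𝟎 s = resp (λ j → sym (inverseʳ-unique _ _ (z⊕y≋𝟎 j))) (span-neg s)

  span-unscale : ∀ {d} {S : Subset d} {a y} → ¬ a ≈ 0# → Span S (scale a y) → Span S y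
  span-unscale {a = a} {y} a≉0 s with inverse a a≉0
  ... | a⁻¹ , aa⁻¹≈1 = resp (λ j → begin
    a⁻¹ * (a * y j)  ≈⟨ solve 3 (λ i a y → i :* (a :* y) := (a :* i) :* y) refl a⁻¹ a (y j) ⟩
    (a * a⁻¹) * y j  ≈⟨ *-congʳ aa⁻¹≈1 ⟩
    1# * y j         ≈⟨ *-identityˡ (y j) ⟩
    y j              ∎) (scaled a⁻¹ s)

  -- With a nonzero leading coefficient the relation could be solved for `x`, placing it in the span
  -- of `S`. This serves both to lengthen independent families and to lower dimension bounds.
  cons-relation : ∀ {d n} {S : Subset d} {x} {y : Vector (Point d) n} (c : Vector Carrier (suc n)) →
                  ¬ Span S x → (∀ i → Span S (y i)) → combination c (x ∷ y) ≋ 𝟎 →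
                  c zero ≈ 0# × combination (tail c) y ≋ 𝟎
  cons-relation {S = S} {x} {y} c x∉ y∈ rel with em {c zero ≈ 0#}
  ... | yes c₀≈0 = c₀≈0 , λ j → begin
    combination (tail c) y j                      ≈⟨ +-identityˡ _ ⟨
    0# + combination (tail c) y j                 ≈⟨ +-congʳ (trans (*-congʳ c₀≈0) (zeroˡ (x j))) ⟨
    c zero * x j + combination (tail c) y j       ≈⟨ rel j ⟩
    0#                                            ∎
  ... | no c₀≉0 = contradiction
    (span-unscale c₀≉0 (span-complement (λ j → trans (+-comm _ _) (rel j)) (span-combination (tail c) y y∈))) x∉

  cons-independent : ∀ {d n} {S : Subset d} {x} {y : Vector (Point d) n} →
                     ¬ Span S x → (∀ i → Span S (y i)) → LinearlyIndependent y → LinearlyIndependent (x ∷ y)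
  cons-independent x∉ y∈ ind c rel with cons-relation c x∉ y∈ rel
  ... | c₀≈0 , rel′ = λ { zero → c₀≈0 ; (suc i) → ind (tail c) rel′ i }

  -- Dimension bounds and Gaussian elimination.

  Nontrivial : ∀ {n} → Vector Carrier n → Set ℓ
  Nontrivial c = ∃ λ i → ¬ c i ≈ 0#

  Dependent : ∀ {d n} → Vector (Point d) n → Set ℓ
  Dependent y = ∃ λ c → Nontrivial c × combination c y ≋ 𝟎

  independent⇒¬dependent : ∀ {d n} {y : Vector (Point d) n} → LinearlyIndependent y → ¬ Dependent y
  independent⇒¬dependent ind (c , (i , cᵢ≉0) , rel) = cᵢ≉0 (ind c rel i)

  -- The span of S has dimension less than N.
  DimBelow : ∀ {d} → ℕ → Subset d → Set ℓ
  DimBelow {d} N S = ∀ {M} → N ℕ.≤ M → (y : Vector (Point d) M) → (∀ i → Span S (y i)) → Dependent y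

  dimBelow-mono : ∀ {d N} {S S′ : Subset d} → S ⊆ Span S′ → DimBelow N S′ → DimBelow N S
  dimBelow-mono S⊆S′ dim N≤M y y∈ = dim N≤M y (span-bind S⊆S′ ∘ y∈)

  -- Prefixing `x` to `N` or more vectors from the smaller span makes `suc N` or more in the larger
  -- one. The resulting relation vanishes at `x`, so it is already a nontrivial relation on the
  -- original vectors.
  dimBelow-pred : ∀ {d N} {S S′ : Subset d} {x} → S ⊆ Span S′ → Span S′ x → ¬ Span S x →
                  DimBelow (suc N) S′ → DimBelow N S
  dimBelow-pred {x = x} S⊆S′ x∈S′ x∉S dim N≤M y y∈
    with dim (ℕ.s≤s N≤M) (x ∷ y) (λ { zero → x∈S′ ; (suc i) → span-bind S⊆S′ (y∈ i) })
  ... | c , nontrivial , rel with cons-relation c x∉S y∈ rel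
  ...   | c₀≈0 , rel′ = tail c , nontrivial-tail nontrivial , rel′
    where
    nontrivial-tail : Nontrivial c → Nontrivial (tail c)
    nontrivial-tail (zero  , c₀≉0) = contradiction c₀≈0 c₀≉0
    nontrivial-tail (suc i , cᵢ≉0) = i , cᵢ≉0

  pivot-coefficients : ∀ {n} (c r : Vector Carrier n) (p : Fin (suc n)) → Vector Carrier (suc n)
  pivot-coefficients c r p = insertAt c p (- dot c r)

  -- Elimination seen from the coefficients: a relation on the reduced family lifts to the full one
  -- once the pivot receives the coefficient `- dot c r`.
  dot-pivot : ∀ {n} (c r : Vector Carrier n) p (f : Vector Carrier (suc n)) →
              dot (pivot-coefficients c r p) f ≈ dot c (λ i → removeAt f p i + - f p * r i)
  dot-pivot c r p f = begin
    dot (pivot-coefficients c r p) f                   ≈⟨ dot-insertAt c p _ f ⟩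
    - dot c r * f p + dot c (removeAt f p)             ≈⟨ +-comm _ _ ⟩
    dot c (removeAt f p) + - dot c r * f p             ≈⟨ +-congˡ (begin
      - dot c r * f p      ≈⟨ -‿distribˡ-* _ _ ⟨
      - (dot c r * f p)    ≈⟨ -‿cong (*-comm _ _) ⟩
      - (f p * dot c r)    ≈⟨ -‿distribˡ-* _ _ ⟩
      - f p * dot c r      ≈⟨ dot-*ʳ (- f p) c r ⟨
      dot c (λ i → - f p * r i) ∎) ⟩
    dot c (removeAt f p) + dot c (λ i → - f p * r i)   ≈⟨ dot-+ʳ c (removeAt f p) (λ i → - f p * r i) ⟨
    dot c (λ i → removeAt f p i + - f p * r i)         ∎

  -- Gaussian elimination: s linear constraints on the coefficients of a
  -- relation cost s dimensions.
  constrained-relation :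
    ∀ {d N} {S : Subset d} → DimBelow N S → ∀ s {M} → s ℕ.+ N ℕ.≤ M →
    (y : Vector (Point d) M) → (∀ i → Span S (y i)) → (a : Vector (Vector Carrier M) s) →
    ∃ λ c → Nontrivial c × combination c y ≋ 𝟎 × (∀ l → dot c (a l) ≈ 0#)
  constrained-relation dim zero N≤M y y∈ a with dim N≤M y y∈
  ... | c , nontrivial , rel = c , nontrivial , rel , λ ()
  constrained-relation {S = S} dim (suc s) {suc M} (ℕ.s≤s s+N≤M) y y∈ a with em {∃ λ p → ¬ a zero p ≈ 0#}
  -- The first constraint is identically zero, so every `c` satisfies it and the whole family is
  -- kept.
  ... | no a₀≈0 with constrained-relation dim s (ℕₚ.m≤n⇒m≤1+n s+N≤M) y y∈ (tail a)
  ...   | c , nontrivial , rel , con = c , nontrivial , rel , λ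
    { zero    → dot-zeroʳ c (λ i → decidable-stable em (λ ≉0 → a₀≈0 (i , ≉0)))
    ; (suc l) → con l }
  constrained-relation {S = S} dim (suc s) {suc M} (ℕ.s≤s s+N≤M) y y∈ a
      | yes (p , a₀ₚ≉0) with inverse (a zero p) a₀ₚ≉0
  ... | a₀ₚ⁻¹ , inv = result
    where
    -- The ratios of the first constraint to its pivot entry: subtracting `r i` times the pivot
    -- vector makes that constraint vanish on the reduced family.
    r : Vector Carrier M
    r i = a₀ₚ⁻¹ * a zero (punchIn p i)

    reduce : Vector Carrier (suc M) → Vector Carrier M
    reduce f i = removeAt f p i + - f p * r i

    y′ : Vector (Point _) M
    y′ i j = reduce (λ i → y i j) i

    y′∈ : ∀ i → Span S (y′ i)
    y′∈ i = add (y∈ (punchIn p i)) (resp (λ j → *-comm (r i) _) (scaled (r i) (span-neg (y∈ p))))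

    a₀-reduced : ∀ i → reduce (a zero) i ≈ 0#
    a₀-reduced i = begin
      aᵢ + - aₚ * (a₀ₚ⁻¹ * aᵢ)    ≈⟨ +-congˡ (-‿distribˡ-* _ _) ⟨
      aᵢ + - (aₚ * (a₀ₚ⁻¹ * aᵢ))  ≈⟨ +-congˡ (-‿cong (trans (sym (*-assoc _ _ _)) (trans (*-congʳ inv) (*-identityˡ aᵢ)))) ⟩
      aᵢ - aᵢ                     ≈⟨ -‿inverseʳ aᵢ ⟩
      0#                          ∎
      where
      aᵢ = a zero (punchIn p i)
      aₚ = a zero p

    result : ∃ λ c → Nontrivial c × combination c y ≋ 𝟎 × (∀ l → dot c (a l) ≈ 0#)
    result with constrained-relation dim s s+N≤M y′ y′∈ (λ l → reduce (a (suc l)))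
    ... | c , (i , cᵢ≉0) , rel , con =
      pivot-coefficients c r p ,
      (punchIn p i , cᵢ≉0 ∘ trans (reflexive (≡.sym (insertAt-punchIn c p _ i)))) ,
      (λ j → trans (dot-pivot c r p (λ i → y i j)) (rel j)) ,
      λ { zero    → trans (dot-pivot c r p (a zero)) (dot-zeroʳ c a₀-reduced)
        ; (suc l) → trans (dot-pivot c r p (a (suc l))) (con l) }

  -- The `d` coordinate equations are imposed as constraints over a zero-dimensional space, where
  -- any nonempty family is already dependent.
  dimBelow-ambient : ∀ {d} (S : Subset d) → DimBelow (suc d) S
  dimBelow-ambient {d} S {M} d<M y y∈
    with constrained-relation {d = 0} {N = 1} {S = λ _ → Lift ℓ ⊤}
           (λ { (ℕ.s≤s _) _ _ → (λ _ → 1#) , (zero , 0≉1 ∘ sym) , λ () })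
           d (ℕₚ.≤-trans (ℕₚ.≤-reflexive (ℕₚ.+-comm d 1)) d<M)
           (λ _ ()) (λ _ → generator _) (λ j i → y i j)
  ... | c , nontrivial , _ , rel = c , nontrivial , rel

  -- Spans with finitely many vectors adjoined.

  infixl 5 _⊹_
  _⊹_ : ∀ {d n} → Subset d → Vector (Point d) n → Subset d
  (S ⊹ x) y = S y ⊎ ∃ λ i → y ≋ x i

  span-⊹ : ∀ {d n} {S : Subset d} {x : Vector (Point d) n} {y} → Span (S ⊹ x) y →
           ∃ λ c → ∃ λ u → Span S u × y ≋ u ⊕ combination c x
  span-⊹ {x = x} {y} (generator (inj₁ s)) =
    (λ _ → 0#) , y , generator s ,
    λ j → sym (trans (+-congˡ (dot-zeroˡ (λ i → x i j) (λ _ → refl))) (+-identityʳ _))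
  span-⊹ {x = x} (generator (inj₂ (i , y≋xᵢ))) =
    δ i , 𝟎 , zero , λ j → trans (y≋xᵢ j) (sym (trans (+-identityˡ _)
      (trans (sum-cong-≋ (λ l → *-comm (δ i l) (x l j))) (dot-δ (λ l → x l j) i))))
  span-⊹ (resp y≋z s) with span-⊹ s
  ... | c , u , u∈ , y≋ = c , u , u∈ , λ j → trans (sym (y≋z j)) (y≋ j)
  span-⊹ {x = x} zero =
    (λ _ → 0#) , 𝟎 , zero , λ j → sym (trans (+-identityˡ _) (dot-zeroˡ (λ i → x i j) (λ _ → refl)))
  span-⊹ {x = x} (add s t) with span-⊹ s | span-⊹ t
  ... | c , u , u∈ , y≋ | c′ , u′ , u′∈ , y′≋ =
    (λ i → c i + c′ i) , u ⊕ u′ , add u∈ u′∈ , λ j → trans (+-cong (y≋ j) (y′≋ j))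
      (trans (solve 4 (λ u s u′ s′ → (u :+ s) :+ (u′ :+ s′) := (u :+ u′) :+ (s :+ s′)) refl (u j) _ (u′ j) _)
             (+-congˡ (sym (dot-+ˡ c c′ (λ i → x i j)))))
  span-⊹ {x = x} (scaled a s) with span-⊹ s
  ... | c , u , u∈ , y≋ =
    (λ i → a * c i) , scale a u , scaled a u∈ , λ j → trans (*-congˡ (y≋ j))
      (trans (distribˡ a (u j) _) (+-congˡ (sym (dot-*ˡ a c (λ i → x i j)))))

  -- Moving the other vectors to the side of `x p` leaves an element of the span of `S`, with
  -- coefficient 1 at `p`.
  relation-at : ∀ {d n} {S : Subset d} (x : Vector (Point d) (suc n)) p → Span (S ⊹ removeAt x p) (x p) →
                ∃ λ c → Span S (combination c x) × ¬ c p ≈ 0#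
  relation-at x p s with span-⊹ s
  ... | c , u , u∈ , xₚ≋ =
    insertAt (λ i → - c i) p 1# ,
    resp (λ j → sym (begin
      combination (insertAt (λ i → - c i) p 1#) x j                     ≈⟨ dot-insertAt _ p 1# (λ i → x i j) ⟩
      1# * x p j + dot (λ i → - c i) (removeAt (λ i → x i j) p)         ≈⟨ +-cong (trans (*-identityˡ _) (xₚ≋ j)) (dot-negˡ c _) ⟩
      (u j + combination c (removeAt x p) j) - combination c (removeAt x p) j ≈⟨ +-assoc _ _ _ ⟩
      u j + (combination c (removeAt x p) j - combination c (removeAt x p) j) ≈⟨ +-congˡ (-‿inverseʳ _) ⟩
      u j + 0#                                                          ≈⟨ +-identityʳ _ ⟩
      u j                                                               ∎)) u∈ ,
    λ ≈0 → 0≉1 (sym (trans (reflexive (≡.sym (insertAt-lookup (λ i → - c i) p 1#))) ≈0))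

-- Relations modulo a span, and translations inside convex hulls.

module FlatPairs {ℓ} (em : ExcludedMiddle ℓ) (ℝ : CompleteOrderedField ℓ) where

  open CompleteOrderedField ℝ hiding (zero)
  open EuclideanSpace ℝ
  open Sums ℝ
  open Order em ℝ
  open LinearAlgebra em ℝ
  open SemiringSum semiring using (sum; sum-cong-≋; ∑-distrib-+; *-distribˡ-sum)
  open VectorEquality setoid using (_≋_)
  open SetoidReasoning setoid
  open SemiringSolver commutativeSemiring using (solve; _:=_; _:+_; _:*_)
  open RingProperties ring using (-1*x≈-x)

  -- A linear relation modulo the span of `S`. For the differences of base points and all directions
  -- this is the condition that Σ cᵢ xᵢ lies in U.
  Relation : ∀ {d n} → Subset d → Vector (Point d) n → Vector Carrier n → Set ℓ
  Relation S x c = Span S (combination c x)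

  relation-+* : ∀ {d n} {S : Subset d} (x : Vector (Point d) n) c c′ t →
                Relation S x c → Relation S x c′ → Relation S x (λ i → c i + t * c′ i)
  relation-+* x c c′ t r r′ = resp
    (λ j → sym (trans (dot-+ˡ c (λ i → t * c′ i) (λ i → x i j)) (+-congˡ (dot-*ˡ t c′ (λ i → x i j)))))
    (add r (scaled t r′))

  relation-scale : ∀ {d n} {S : Subset d} (x : Vector (Point d) n) c a →
                   Relation S x c → Relation S x (λ i → a * c i)
  relation-scale x c a r = resp (λ j → sym (dot-*ˡ a c (λ i → x i j))) (scaled a r)

  -- For large `t`, a coordinate of `c zero + t * e` vanishes only if it does so in both summands;
  -- hence supports can be united one relation at a time.
  relation-merge : ∀ {d n m} {S : Subset d} (x : Vector (Point d) n) (c : Vector (Vector Carrier n) m) →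
                   (∀ l → Relation S x (c l)) →
                   ∃ λ c′ → Relation S x c′ × ∀ l i → ¬ c l i ≈ 0# → ¬ c′ i ≈ 0#
  relation-merge {m = zero} x c rel =
    (λ _ → 0#) , resp (λ j → sym (dot-zeroˡ (λ i → x i j) (λ _ → refl))) zero , λ ()
  relation-merge {m = suc m} x c rel with relation-merge x (tail c) (rel ∘ suc)
  ... | e , e-rel , e-supp
    with eventually-witness (eventually-∀ {P = λ i t → (¬ c zero i ≈ 0# ⊎ ¬ e i ≈ 0#) → ¬ c zero i + t * e i ≈ 0#}
           (λ i → separate (c zero i) (e i)))
    where
    separate : ∀ a b → Eventually (λ t → (¬ a ≈ 0# ⊎ ¬ b ≈ 0#) → ¬ a + t * b ≈ 0#)
    separate a b with em {¬ a ≈ 0# ⊎ ¬ b ≈ 0#}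
    ... | yes ≉0 = proj₁ (eventually-≉0 ≉0) , λ t M≤t _ → proj₂ (eventually-≉0 ≉0) t M≤t
    -- Here the implication is vacuous, and any threshold would do.
    ... | no  ≈0 = 0# , λ t _ ≉0 → contradiction ≉0 ≈0
  ...   | t , supp = (λ i → c zero i + t * e i) , relation-+* x (c zero) e t (rel zero) e-rel , λ
    { zero    i ≉0 → supp i (inj₁ ≉0)
    ; (suc l) i ≉0 → supp i (inj₂ (e-supp l i ≉0)) }

  -- Rescaling `μ` to `ν` with `sgn b * ν j ≈ 1` makes `c + t * ν` acquire the sign `b` at `j` for
  -- large `t`; the zeros of `μ` protect the other recorded coordinates.
  relation-flip :
    ∀ {d n} {S : Subset d} {x : Vector (Point d) n} {c μ : Vector Carrier n} {j} →
    Relation S x c → (∀ i → ¬ c i ≈ 0#) → Relation S x μ → ¬ μ j ≈ 0# → ∀ b →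
    ∃ λ c′ → Relation S x c′ × (∀ i → ¬ c′ i ≈ 0#) × Sign b (c′ j) × ∀ i → μ i ≈ 0# → c′ i ≈ c i
  relation-flip {n = n} {S} {x} {c} {μ} {j} rel c≉0 μ-rel μⱼ≉0 b = combine
    (eventually-witness (eventually-× (eventually-∀ (λ i → eventually-≉0 (inj₁ (c≉0 i)))) (eventually-sign {b = b} (c j) σνⱼ≈1)))
    where
    μⱼ⁻¹ : Carrier
    μⱼ⁻¹ = proj₁ (inverse (μ j) μⱼ≉0)

    ν : Vector Carrier n
    ν i = (sgn b * μⱼ⁻¹) * μ i

    σνⱼ≈1 : sgn b * ν j ≈ 1#
    σνⱼ≈1 = begin
      sgn b * ((sgn b * μⱼ⁻¹) * μ j)     ≈⟨ solve 3 (λ σ i m → σ :* ((σ :* i) :* m) := (σ :* σ) :* (m :* i)) refl (sgn b) μⱼ⁻¹ (μ j) ⟩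
      (sgn b * sgn b) * (μ j * μⱼ⁻¹)     ≈⟨ *-cong (sgn-square b) (proj₂ (inverse (μ j) μⱼ≉0)) ⟩
      1# * 1#                            ≈⟨ *-identityˡ 1# ⟩
      1#                                 ∎

    combine : (∃ λ t → (∀ i → ¬ c i + t * ν i ≈ 0#) × Sign b (c j + t * ν j)) →
              ∃ λ c′ → Relation S x c′ × (∀ i → ¬ c′ i ≈ 0#) × Sign b (c′ j) × ∀ i → μ i ≈ 0# → c′ i ≈ c i
    combine (t , c′≉0 , signⱼ) =
      (λ i → c i + t * ν i) , relation-+* x c ν t rel (relation-scale x μ (sgn b * μⱼ⁻¹) μ-rel) , c′≉0 , signⱼ ,
      λ i μᵢ≈0 → trans (+-congˡ (trans (*-congˡ (trans (*-congˡ μᵢ≈0) (zeroʳ _))) (zeroʳ t))) (+-identityʳ (c i))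

  -- The weights stay positive on every flat, so translating by the sum of all
  -- directions does not leave the convex hull.
  span-translate-conv :
    ∀ {n k d} {H : Fin n → Subset d} (flat : ∀ i → IsFlat k (H i)) (w : Vector Carrier n) →
    (∀ i → Positive (w i)) → sum w ≈ 1# →
    ∀ {a x} → Span (λ y → ∃ λ i → ∃ λ c → y ≋ combination c (proj₁ (proj₂ (flat i)))) a →
    x ≋ combination w (λ i → proj₁ (flat i)) ⊕ a → conv (⋃ (Fin n) H) x
  span-translate-conv {n} {k} {d} {H} flat w w>0 Σw≈1 {a} {x} a∈ x≋ with distribute a∈
    where
    v : Fin n → Vector (Point d) k
    v i = proj₁ (proj₂ (flat i))

    distribute : ∀ {y} → Span (λ y → ∃ λ i → ∃ λ c → y ≋ combination c (v i)) y →
                 ∃ λ (c : Vector (Vector Carrier k) n) → y ≋ combination w (λ i → combination (c i) (v i))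
    distribute (generator {y} (i , c , y≋)) with inverse (w i) (proj₂ (w>0 i))
    ... | wᵢ⁻¹ , inv =
      -- The whole direction is loaded on the i-th flat, divided by its weight so that the weighted
      -- mean restores it.
      (λ l q → δ i l * (wᵢ⁻¹ * c q)) , λ j → sym (begin
        dot w (λ l → dot (λ q → δ i l * (wᵢ⁻¹ * c q)) (λ q → v l q j))
          ≈⟨ dot-cong {f = λ l → dot (λ q → δ i l * (wᵢ⁻¹ * c q)) (λ q → v l q j)} (λ _ → refl) (λ l → trans
               (dot-*ˡ (δ i l) (λ q → wᵢ⁻¹ * c q) (λ q → v l q j)) (*-congˡ (dot-*ˡ wᵢ⁻¹ c (λ q → v l q j)))) ⟩
        dot w (λ l → δ i l * (wᵢ⁻¹ * combination c (v l) j))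
          ≈⟨ sum-cong-≋ (λ l → solve 4 (λ w δ i s → w :* (δ :* (i :* s)) := (w :* (i :* s)) :* δ) refl (w l) (δ i l) wᵢ⁻¹ _) ⟩
        dot (λ l → w l * (wᵢ⁻¹ * combination c (v l) j)) (δ i)
          ≈⟨ dot-δ (λ l → w l * (wᵢ⁻¹ * combination c (v l) j)) i ⟩
        w i * (wᵢ⁻¹ * combination c (v i) j)
          ≈⟨ trans (sym (*-assoc _ _ _)) (trans (*-congʳ inv) (*-identityˡ _)) ⟩
        combination c (v i) j
          ≈⟨ y≋ j ⟨
        y j ∎)
    distribute (resp x≋y s) with distribute s
    ... | c , x≋ = c , λ j → trans (sym (x≋y j)) (x≋ j)
    distribute zero =
      (λ _ _ → 0#) , λ j → sym (dot-zeroʳ w (λ i → dot-zeroˡ (λ q → v i q j) (λ _ → refl)))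
    distribute (add s t) with distribute s | distribute t
    ... | c , s≋ | e , t≋ = (λ i q → c i q + e i q) , λ j → trans (+-cong (s≋ j) (t≋ j)) (sym (trans
      (dot-cong {c = w} (λ _ → refl) (λ i → dot-+ˡ (c i) (e i) (λ q → v i q j)))
      (dot-+ʳ w (λ i → combination (c i) (v i) j) (λ i → combination (e i) (v i) j))))
    distribute (scaled b s) with distribute s
    ... | c , s≋ = (λ i q → b * c i q) , λ j → trans (*-congˡ (s≋ j)) (sym (trans
      (dot-cong {c = w} (λ _ → refl) (λ i → dot-*ˡ b (c i) (λ q → v i q j)))
      (dot-*ʳ b w (λ i → combination (c i) (v i) j))))
  ... | c , a≋ = n , w , y , proj₁ ∘ w>0 , Σw≈1 ,
    (λ i → i , proj₂ (proj₂ (proj₂ (proj₂ (flat i)))) (c i , λ _ → refl)) ,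
    λ j → trans (x≋ j) (trans (+-congˡ (a≋ j)) (sym (dot-+ʳ w (λ i → proj₁ (flat i) j) _)))
    where
    y : Vector (Point d) n
    y i = proj₁ (flat i) ⊕ combination (c i) (proj₁ (proj₂ (flat i)))

  -- The constraints kill the coefficients of `x` at the places `T`. The `x`-part of the relation
  -- lies in the span of `S` because the `w`-part does, and it is nontrivial because otherwise
  -- independence of `w` would make all coefficients zero.
  relation-avoiding :
    ∀ {d N n m s} {S : Subset d} {x : Vector (Point d) n} → DimBelow N (S ⊹ x) →
    (w : Vector (Point d) m) → LinearlyIndependent w → (∀ i → Span S (w i)) →
    (T : Fin s → Fin n) → s ℕ.+ N ℕ.≤ m ℕ.+ n →
    ∃ λ c → Nontrivial c × Relation S x c × ∀ l → c (T l) ≈ 0#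
  relation-avoiding {d} {n = n} {m} {s} {S} {x} dim w ind w∈ T s+N≤m+n = result
    where
    family∈ : ∀ i → Span (S ⊹ x) ((w ++ x) i)
    family∈ i with splitAt m i
    ... | inj₁ l = span-mono inj₁ (w∈ l)
    ... | inj₂ l = generator (inj₂ (l , λ _ → refl))

    split : ∀ c → combination c (w ++ x) ≋ combination (take m {n} c) w ⊕ combination (drop m {n} c) x
    split c j = trans (dot-split m c (λ i → (w ++ x) i j)) (+-cong
      (dot-cong {c = take m {n} c} (λ _ → refl) (λ i → reflexive (≡.cong (λ y → y j) (lookup-++ˡ w x i))))
      (dot-cong {c = drop m {n} c} (λ _ → refl) (λ i → reflexive (≡.cong (λ y → y j) (lookup-++ʳ w x i)))))

    result : ∃ λ c → Nontrivial c × Relation S x c × ∀ l → c (T l) ≈ 0#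
    result with constrained-relation dim s s+N≤m+n (w ++ x) family∈ (λ l → δ (m ↑ʳ T l))
    ... | c , (i , cᵢ≉0) , rel , con with em {Nontrivial (drop m {n} c)}
    ...   | yes nontrivial =
      drop m {n} c , nontrivial ,
      span-complement (λ j → trans (sym (split c j)) (rel j)) (span-combination (take m {n} c) w w∈) ,
      λ l → trans (sym (dot-δ c (m ↑ʳ T l))) (con l)
    ...   | no trivial = contradiction (c≈0 i) cᵢ≉0
      where
      drop≈0 : ∀ l → drop m {n} c l ≈ 0#
      drop≈0 l = decidable-stable em (λ ≉0 → trivial (l , ≉0))

      take≈0 : ∀ l → take m {n} c l ≈ 0#
      take≈0 = ind (take m {n} c) (λ j → begin
        combination (take m {n} c) w j
          ≈⟨ trans (+-congˡ (dot-zeroˡ (λ i → x i j) drop≈0)) (+-identityʳ _) ⟨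
        combination (take m {n} c) w j + combination (drop m {n} c) x j
          ≈⟨ split c j ⟨
        combination c (w ++ x) j
          ≈⟨ rel j ⟩
        0# ∎)

      c≈0 : ∀ i → c i ≈ 0#
      c≈0 i with splitAt m i in eq
      ... | inj₁ l = ≡.subst (λ i → c i ≈ 0#) (splitAt⁻¹-↑ˡ eq) (take≈0 l)
      ... | inj₂ l = ≡.subst (λ i → c i ≈ 0#) (splitAt⁻¹-↑ʳ eq) (drop≈0 l)

  -- Needed to write an element of U as a sum of one from W_A and one from W_B.
  span-∪ : ∀ {d} {S S₁ S₂ : Subset d} → (∀ {y} → S y → S₁ y ⊎ S₂ y) → ∀ {y} → Span S y →
           ∃ λ a → ∃ λ b → Span S₁ a × Span S₂ b × y ≋ a ⊕ b
  span-∪ f {y} (generator s) with f s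
  ... | inj₁ s₁ = y , 𝟎 , generator s₁ , zero , λ j → sym (+-identityʳ (y j))
  ... | inj₂ s₂ = 𝟎 , y , zero , generator s₂ , λ j → sym (+-identityˡ (y j))
  span-∪ f (resp x≋y s) with span-∪ f s
  ... | a , b , a∈ , b∈ , x≋ = a , b , a∈ , b∈ , λ j → trans (sym (x≋y j)) (x≋ j)
  span-∪ f zero = 𝟎 , 𝟎 , zero , zero , λ j → sym (+-identityʳ 0#)
  span-∪ f (add s t) with span-∪ f s | span-∪ f t
  ... | a , b , a∈ , b∈ , s≋ | a′ , b′ , a′∈ , b′∈ , t≋ =
    a ⊕ a′ , b ⊕ b′ , add a∈ a′∈ , add b∈ b′∈ , λ j → trans (+-cong (s≋ j) (t≋ j))
      (solve 4 (λ a b a′ b′ → (a :+ b) :+ (a′ :+ b′) := (a :+ a′) :+ (b :+ b′)) refl (a j) (b j) (a′ j) (b′ j))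
  span-∪ f (scaled r s) with span-∪ f s
  ... | a , b , a∈ , b∈ , s≋ =
    scale r a , scale r b , scaled r a∈ , scaled r b∈ , λ j → trans (*-congˡ (s≋ j)) (distribˡ r (a j) (b j))

  -- The contribution of one pair to the difference of the two centres: with the flat chosen by the
  -- sign of `l`, the absolute value of `l` times (chosen minus other) equals `l` times (`true`
  -- minus `false`).
  balance : ∀ b κ l (p : Bool → Carrier) →
            (κ * (sgn b * l)) * p b ≈ (κ * l) * (p true - p false) + (κ * (sgn b * l)) * p (not b)
  balance true κ l p = begin
    (κ * (1# * l)) * p true                                       ≈⟨ *-congʳ (*-congˡ (*-identityˡ l)) ⟩
    (κ * l) * p true                                              ≈⟨ *-congˡ (x-y+y≈x (p true) (p false)) ⟨
    (κ * l) * ((p true - p false) + p false)                      ≈⟨ distribˡ _ _ _ ⟩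
    (κ * l) * (p true - p false) + (κ * l) * p false              ≈⟨ +-congˡ (*-congʳ (*-congˡ (*-identityˡ l))) ⟨
    (κ * l) * (p true - p false) + (κ * (1# * l)) * p false       ∎
  balance false κ l p = sym (begin
    (κ * l) * (p true - p false) + (κ * (- 1# * l)) * p true
      -- Negation becomes multiplication by `- 1#`, which leaves a semiring identity and one
      -- cancelling term.
      ≈⟨ +-congʳ (*-congˡ (+-congˡ (-1*x≈-x (p false)))) ⟨
    (κ * l) * (p true + - 1# * p false) + (κ * (- 1# * l)) * p true
      ≈⟨ solve 5 (λ κ l a m c → (κ :* l) :* (a :+ m :* c) :+ (κ :* (m :* l)) :* a
                             := (κ :* (m :* l)) :* c :+ (κ :* l) :* (a :+ m :* a)) refl κ l (p true) (- 1#) (p false) ⟩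
    (κ * (- 1# * l)) * p false + (κ * l) * (p true + - 1# * p true)
      ≈⟨ +-congˡ (trans (*-congˡ (trans (+-congˡ (-1*x≈-x (p true))) (-‿inverseʳ (p true)))) (zeroʳ _)) ⟩
    (κ * (- 1# * l)) * p false + 0#
      ≈⟨ +-identityʳ _ ⟩
    (κ * (- 1# * l)) * p false ∎)

  ≡-or-not : ∀ b b′ → b ≡ b′ ⊎ b ≡ not b′
  ≡-or-not true  true  = inj₁ ≡.refl
  ≡-or-not true  false = inj₂ ≡.refl
  ≡-or-not false true  = inj₂ ≡.refl
  ≡-or-not false false = inj₁ ≡.refl

  conv-mono : ∀ {d} (S S′ : Subset d) → S ⊆ S′ → conv S ⊆ conv S′
  conv-mono S S′ S⊆S′ (n , w , y , w≥0 , Σw≈1 , y∈ , x≋) = n , w , y , w≥0 , Σw≈1 , S⊆S′ ∘ y∈ , x≋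

  -- Splittings of a fixed family of flat pairs.

  module Family {n k d} {H : Fin n → Bool → Subset d} (flat : ∀ i b → IsFlat k (H i b)) where

    base : Fin n → Bool → Point d
    base i b = proj₁ (flat i b)

    basis : Fin n → Bool → Vector (Point d) k
    basis i b = proj₁ (proj₂ (flat i b))

    basis-independent : ∀ i b → LinearlyIndependent (basis i b)
    basis-independent i b = proj₁ (proj₂ (proj₂ (flat i b)))

    difference : Vector (Point d) n
    difference i = base i true ⊕ neg (base i false)

    -- `T` lists selected flats: `id` selects all of them, `λ l → l , ε l` those in A. This is the
    -- union of their direction spaces; its `Span` is their sum.
    Directions : {I : Set} → (I → Fin n × Bool) → Subset d
    Directions T y = ∃ λ l → let (i , b) = T l in ∃ λ c → y ≋ combination c (basis i b)

    basis∈ : ∀ {I : Set} (T : I → Fin n × Bool) l q → Directions T (basis (proj₁ (T l)) (proj₂ (T l)) q)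
    basis∈ T l q = l , δ q , λ j → sym (trans (sum-cong-≋ (λ i → *-comm (δ q i) _)) (dot-δ _ q))

    record Splitting : Set (Level.suc ℓ) where
      constructor splits
      field
        ε      : Fin n → Bool
        F      : Subset d
        isFlat : IsFlat k F
        F⊆     : F ⊆ conv (⋃ (Fin n) (λ i → H i (ε i))) ∩ conv (⋃ (Fin n) (λ i → H i (not (ε i))))

    directions-⊆ : ∀ {I J : Set} {T : I → Fin n × Bool} {T′ : J → Fin n × Bool} (f : I → J) →
                   (∀ l → T l ≡ T′ (f l)) → Directions T ⊆ Directions T′
    directions-⊆ f eq {y} (l , c , y≋) =
      f l , ≡.subst (λ (i , b) → ∃ λ c → y ≋ combination c (basis i b)) (eq l) (c , y≋)

    -- The weighted centres of A and B differ by `a ⊕ b` with `a` in W_A and `b` in W_B, so both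
    -- hulls reach a common point `q`. The directions of the `i`-th flat of B lie in W_B trivially
    -- and in W_A by hypothesis.
    splitting-from-relation :
      ∀ (ε : Fin n → Bool) (c : Vector Carrier n) → (∀ i → Sign (ε i) (c i)) →
      Relation (Directions id) difference c →
      ∀ i → (∀ q → Span (Directions (λ l → l , ε l)) (basis i (not (ε i)) q)) → Splitting
    splitting-from-relation ε c signs rel i₀ basis∈A
      -- The index `i₀` also shows that the sum is nonempty, so the total weight can be normalised
      -- to 1.
      with sum-positive i₀ (λ i → sgn (ε i) * c i) signs
    ... | total>0 with inverse _ (proj₂ total>0)
    ...   | κ , inv
      with span-∪ {S₁ = Directions (λ l → l , ε l)} {S₂ = Directions (λ l → l , not (ε l))}
             (λ {y} → λ { ((i , b) , c , y≋) →
               [ (λ eq → inj₁ (i , c , ≡.subst (λ b → y ≋ combination c (basis i b)) eq y≋))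
               , (λ eq → inj₂ (i , c , ≡.subst (λ b → y ≋ combination c (basis i b)) eq y≋)) ]′ (≡-or-not b (ε i)) })
             (relation-scale difference c κ rel)
    ...     | a , b , a∈ , b∈ , rel≋ =
      splits ε (q +Span f) (q , f , basis-independent i₀ (not (ε i₀)) , id , id)
      λ { (e , x≋) →
        span-translate-conv (λ i → flat i (ε i)) w w>0 Σw≈1
          (add (span-neg a∈) (span-combination e f basis∈A))
          (λ j → trans (x≋ j) (trans (+-congʳ (q≋ j)) (+-assoc _ _ _))) ,
        span-translate-conv (λ i → flat i (not (ε i))) w w>0 Σw≈1
          (add b∈ (generator (i₀ , e , λ _ → refl)))
          (λ j → trans (x≋ j) (+-assoc _ _ _)) }
      where
      w : Vector Carrier n
      w i = κ * (sgn (ε i) * c i)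

      w>0 : ∀ i → Positive (w i)
      w>0 i = *-positive (inverse-positive total>0 inv) (signs i)

      Σw≈1 : sum w ≈ 1#
      Σw≈1 = trans (sym (*-distribˡ-sum κ (λ i → sgn (ε i) * c i))) (trans (*-comm κ _) inv)

      centreᴬ centreᴮ q : Point d
      centreᴬ = combination w (λ i → base i (ε i))
      centreᴮ = combination w (λ i → base i (not (ε i)))
      -- Seen from A, the same point is `centreᴬ` minus `a`.
      q = centreᴮ ⊕ b

      f : Vector (Point d) k
      f = basis i₀ (not (ε i₀))

      centres : ∀ j → centreᴬ j ≈ combination (λ i → κ * c i) difference j + centreᴮ j
      centres j = trans (sum-cong-≋ (λ i → balance (ε i) κ (c i) (λ b → base i b j)))
        (∑-distrib-+ (λ i → (κ * c i) * difference i j) _)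

      q≋ : ∀ j → q j ≈ centreᴬ j - a j
      q≋ j = sym (begin
        centreᴬ j - a j                      ≈⟨ +-congʳ (trans (centres j) (+-congʳ (rel≋ j))) ⟩
        ((a j + b j) + centreᴮ j) - a j      ≈⟨ solve 4 (λ a b m n → ((a :+ b) :+ m) :+ n := (m :+ b) :+ (a :+ n)) refl (a j) (b j) (centreᴮ j) (- a j) ⟩
        (centreᴮ j + b j) + (a j - a j)      ≈⟨ trans (+-congˡ (-‿inverseʳ (a j))) (+-identityʳ _) ⟩
        centreᴮ j + b j                      ∎)

    -- Each round flips one sign, keeping those recorded in T, so that the
    -- directions of the flats in T gain a dimension.
    splitting-by-flips :
      DimBelow (n ℕ.+ k) (Directions id ⊹ difference) →
      ∀ r s → n ℕ.≤ s ℕ.+ r → (T : Fin (suc s) → Fin n × Bool) →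
      (w : Vector (Point d) (s ℕ.+ k)) → LinearlyIndependent w → (∀ l → Span (Directions T) (w l)) →
      ∀ c → (∀ i → ¬ c i ≈ 0#) → Relation (Directions id) difference c →
      (∀ l → Sign (proj₂ (T l)) (c (proj₁ (T l)))) → Splitting
    splitting-by-flips dim r s n≤s+r T w ind w∈ c c≉0 rel signs
      with em {∃ λ i → ∀ q → Span (Directions T) (basis i (not (proj₁ (sign-exists (c≉0 i)))) q)}
    -- By `sign-unique` the recorded signs are the current ones, so every flat in `T` belongs to A.
    ... | yes (i , h) = splitting-from-relation ε c (λ i → proj₂ (sign-exists (c≉0 i))) rel i
      (λ q → span-mono (directions-⊆ (proj₁ ∘ T) (λ l → ≡.cong (proj₁ (T l) ,_)
        (sign-unique _ _ (signs l) (proj₂ (sign-exists (c≉0 (proj₁ (T l)))))))) (h q))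
      where
      ε : Fin n → Bool
      ε i = proj₁ (sign-exists (c≉0 i))
    ... | no none = continue r n≤s+r
      where
      ε : Fin n → Bool
      ε i = proj₁ (sign-exists (c≉0 i))

      outside : ∀ i → ∃ λ q → ¬ Span (Directions T) (basis i (not (ε i)) q)
      outside i = ¬∀⟶∃¬ k _ (λ _ → em) (λ h → none (i , h))

      continue : ∀ r → n ℕ.≤ s ℕ.+ r → Splitting
      -- Now `n ≤ s`, so the `s + k` independent vectors `w` exceed the dimension bound.
      continue zero n≤s+0 = contradiction
        (dim (ℕₚ.+-monoˡ-≤ k (ℕₚ.≤-trans n≤s+0 (ℕₚ.≤-reflexive (ℕₚ.+-identityʳ s)))) w
          (λ l → span-mono (inj₁ ∘ directions-⊆ T (λ _ → ≡.refl)) (w∈ l)))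
        (independent⇒¬dependent ind)
      -- Any pair would do here: a direction of its flat in B outside the span lengthens `w` by one
      -- for the dimension count.
      continue (suc r) n≤s+1+r with proj₁ (T zero)
      ... | i₀ with outside i₀
      ...   | q₀ , v₀∉
        with relation-avoiding {s = suc s} {x = difference} dim (basis i₀ (not (ε i₀)) q₀ ∷ w) (cons-independent v₀∉ w∈ ind)
               (λ { zero → generator (basis∈ id (i₀ , not (ε i₀)) q₀)
                  ; (suc l) → span-mono (directions-⊆ T (λ _ → ≡.refl)) (w∈ l) })
               (proj₁ ∘ T)
               -- The count is tight: `suc s` constraints plus the bound `n + k` equal `suc (s + k)`
               -- directions plus `n` differences.
               (ℕₚ.≤-reflexive (≡.cong suc (≡.trans (≡.cong (s ℕ.+_) (ℕₚ.+-comm n k)) (≡.sym (ℕₚ.+-assoc s k n)))))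
      ...     | μ , (j , μⱼ≉0) , μ-rel , μ-T = recurse (relation-flip rel c≉0 μ-rel μⱼ≉0 b)
        where
        b : Bool
        -- As `μ` is nonzero at `j`, pair `j` is not recorded in `T`. The flip carries its flat from
        -- B into A, and `outside j` gives a direction of that flat enlarging the span.
        b = not (ε j)

        q : Fin k
        q = proj₁ (outside j)

        recurse : (∃ λ c′ → Relation (Directions id) difference c′ × (∀ i → ¬ c′ i ≈ 0#) × Sign b (c′ j) ×
                   ∀ i → μ i ≈ 0# → c′ i ≈ c i) → Splitting
        recurse (c′ , rel′ , c′≉0 , signⱼ , c′≈c) = splitting-by-flips dim r (suc s)
          (ℕₚ.≤-trans n≤s+1+r (ℕₚ.≤-reflexive (ℕₚ.+-suc s r)))
          ((j , b) ∷ T) (basis j b q ∷ w) (cons-independent (proj₂ (outside j)) w∈ ind)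
          (λ { zero    → generator (basis∈ ((j , b) ∷ T) zero q)
             ; (suc l) → span-mono (directions-⊆ suc (λ _ → ≡.refl)) (w∈ l) })
          c′ c′≉0 rel′
          (λ { zero    → signⱼ
             ; (suc l) → positive-resp (*-congˡ (sym (c′≈c _ (μ-T l)))) (signs l) })

  -- Reduction to a relation with full support.

  open Family public

  -- Adding flats only enlarges the hulls, so the restored pair may be distributed either way;
  -- `true` is an arbitrary choice.
  splitting-extend : ∀ {n k d} {H : Fin (suc n) → Bool → Subset d} {flat : ∀ i b → IsFlat k (H i b)} i →
                     Splitting (flat ∘ punchIn i) → Splitting flat
  splitting-extend {H = H} i (splits ε F isFlat F⊆) = splits ε′ F isFlat λ x∈ →
    conv-mono (⋃ _ (λ l → H (punchIn i l) (ε l))) (⋃ _ (λ l → H l (ε′ l)))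
      (λ (l , y∈) → punchIn i l , ≡.subst (λ b → H (punchIn i l) b _) (ε≡ l) y∈) (proj₁ (F⊆ x∈)) ,
    conv-mono (⋃ _ (λ l → H (punchIn i l) (not (ε l)))) (⋃ _ (λ l → H l (not (ε′ l))))
      (λ (l , y∈) → punchIn i l , ≡.subst (λ b → H (punchIn i l) (not b) _) (ε≡ l) y∈) (proj₂ (F⊆ x∈))
    where
    ε′ : Fin _ → Bool
    ε′ = insertAt ε i true

    ε≡ : ∀ l → ε l ≡ ε′ (punchIn i l)
    ε≡ l = ≡.sym (insertAt-punchIn ε i true l)

  -- The flips start at `s = 0`, from one flat of A and its `k` basis vectors.
  splitting-from-full-support :
    ∀ {n k d} {H : Fin (suc n) → Bool → Subset d} (flat : ∀ i b → IsFlat k (H i b)) →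
    DimBelow (suc n ℕ.+ k) (Directions flat id ⊹ difference flat) →
    ∀ c → Relation (Directions flat id) (difference flat) c → (∀ i → ¬ c i ≈ 0#) → Splitting flat
  splitting-from-full-support {n} flat dim c rel c≉0 = splitting-by-flips flat dim (suc n) 0 ℕₚ.≤-refl (λ _ → zero , b)
    (basis flat zero b) (basis-independent flat zero b)
    (λ q → generator (basis∈ flat (λ _ → zero , b) zero q)) c c≉0 rel (λ _ → proj₂ (sign-exists (c≉0 zero)))
    where
    b : Bool
    b = proj₁ (sign-exists (c≉0 zero))

  -- A pair whose difference is not in the span of the directions and the other
  -- differences cannot take part in a relation; dropping it costs a dimension.
  splitting : ∀ n {k d} {H : Fin (suc n) → Bool → Subset d} (flat : ∀ i b → IsFlat k (H i b)) →
              DimBelow (suc n ℕ.+ k) (Directions flat id ⊹ difference flat) → Splitting flat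
  splitting n {k} {d} {H} flat dim = by-cases em
    where
    Redundant : Fin (suc n) → Set ℓ
    Redundant i = Span (Directions flat id ⊹ removeAt (difference flat) i) (difference flat i)

    without : ∀ m {H : Fin (suc m) → Bool → Subset d} (flat : ∀ i b → IsFlat k (H i b)) i →
              DimBelow (m ℕ.+ k) (Directions flat id ⊹ removeAt (difference flat) i) → Splitting flat
    -- A single pair is never dropped: the span would have dimension below `k`, yet it contains the
    -- `k` basis vectors of a flat.
    without zero flat i dim′ = contradiction
      (dim′ ℕₚ.≤-refl (basis flat i true) (λ q → generator (inj₁ (basis∈ flat id (i , true) q))))
      (independent⇒¬dependent (basis-independent flat i true))
    without (suc m) flat i dim′ = splitting-extend i (splitting m (flat ∘ punchIn i) (dimBelow-mono
      [ (λ { ((l , b) , c , y≋) → generator (inj₁ ((punchIn i l , b) , c , y≋)) })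
      , generator ∘ inj₂ ]′ dim′))

    by-cases : Dec (∀ i → Redundant i) → Splitting flat
    by-cases (yes h) =
      -- Each redundant difference yields a relation nonzero at its own index; merging them gives
      -- full support.
      let relation i         = relation-at (difference flat) i (h i)
          (c , rel , c-supp) = relation-merge (difference flat) (proj₁ ∘ relation) (λ i → proj₁ (proj₂ (relation i)))
      in splitting-from-full-support flat dim c rel (λ i → c-supp i i (proj₂ (proj₂ (relation i))))
    by-cases (no ¬h) =
      let (i , xᵢ∉) = ¬∀⟶∃¬ (suc n) Redundant (λ _ → em) ¬h
      in without n flat i (dimBelow-pred
        [ generator ∘ inj₁ , (λ { (l , y≋) → generator (inj₂ (punchIn i l , y≋)) }) ]′
        (generator (inj₂ (i , λ _ → refl))) xᵢ∉ dim)

-- Matching the number of pairs to the ambient dimension.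

open import Data.Nat.Base using (_≤_; _+_; _∸_)

theorem3 : ∀ {ℓ} → ExcludedMiddle ℓ → (ℝ : CompleteOrderedField ℓ) →
    let open EuclideanSpace ℝ in
    (k d : ℕ) → k ≤ d →
    (H : Fin (d ∸ k + 1) → Bool → Subset d) →
    (∀ i b → IsFlat k (H i b)) →
    Σ (Fin (d ∸ k + 1) → Bool) λ ε →
      let A = λ i → H i (ε i)
          B = λ i → H i (not (ε i))
      in Σ (Subset d) λ F → IsFlat k F × F ⊆ conv (⋃ (Fin (d ∸ k + 1)) A) ∩ conv (⋃ (Fin (d ∸ k + 1)) B)
theorem3 em ℝ k d k≤d H flat =
  let open EuclideanSpace ℝ
      open LinearAlgebra em ℝ
      open FlatPairs em ℝ
      splits ε F isFlat F⊆ = ≡.subst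
        (λ m → (H : Fin m → Bool → Subset d) (flat : ∀ i b → IsFlat k (H i b)) → Splitting flat)
        (ℕₚ.+-comm 1 (d ∸ k))
        -- With `suc (d ∸ k)` pairs the required bound, number of pairs plus `k`, is exactly
        -- `suc d`, which the ambient space provides.
        (λ H flat → splitting (d ∸ k) flat (≡.subst (λ N → DimBelow N (Directions flat id ⊹ difference flat))
          (≡.cong suc (≡.sym (ℕₚ.m∸n+n≡m k≤d))) (dimBelow-ambient _)))
        H flat
  in ε , F , isFlat , F⊆
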